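{- For all positive integers $p$ and $g$ there exists a split graph $G$ of order $n = 3g + 2p - 2$ with $\gamma_p(G) = g$ and $rad_p(G) = p$; in particular $rad_p(G) = \frac{n - 3\gamma_p(G)}{2} + 1$.
   Context: All graphs are finite, simple, undirected and non-empty. A split graph is a graph whose vertex set can be partitioned into an independent set and a set inducing a clique. Here the split graphs considered are connected, with a vertex partition $V(G) = C \sqcup I$ in which $C$ and $I$ are non-empty, $C$ induces a maximum clique of $G$, and $I$ is an independent set. For a graph $G$ and $S \subseteq V(G)$, define $P^1_G(S) = N[S]$ (the closed neighbourhood of $S$), and for $i \geq 1$ let $V^i = \{v \in P^i_G(S) : |N[v] \setminus P^i_G(S)| \leq 1\}$ and $P^{i+1}_G(S) = P^i_G(S) \cup N[V^i]$. The set $S$ is a power dominating set (PDS) of $G$ if $P^i_G(S) = V(G)$ for some $i \ge 1$. The power domination number $\gamma_p(G)$ is the minimum cardinality of a PDS of $G$. For a PDS $S$, $rad_p(G,S) = \min\{i \geq 1 : P^i_G(S) = V(G)\}$. The propagation radius of $G$ is $rad_p(G) = \min\{rad_p(G,S) : S \text{ is a PDS of } G \text{ with } |S| = \gamma_p(G)\}$. -}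

module Defs where

open import Data.Fin.Base using (Fin)
open import Data.Fin.Properties using (any?) renaming (_≟_ to _≟ᶠ_)
open import Data.Fin.Subset using (Subset; _∈_; _∪_; _∩_; _─_; ⊤; ⊥; ∣_∣; Nonempty)
open import Data.Fin.Subset.Properties using (_∈?_)
open import Data.Nat.Base using (ℕ; zero; suc; _≤_)
open import Data.Nat.Properties using (_≤?_)
open import Data.Product.Base using (∃; _×_)
open import Data.Vec.Base using (tabulate)
open import Level using (Level)
open import Relation.Binary.Construct.Closure.ReflexiveTransitive using (Star)
import Relation.Binary.Definitions as Binary
open import Relation.Binary.PropositionalEquality.Core using (_≡_; _≢_)
open import Relation.Nullary.Decidable.Core using (does; _×-dec_; _⊎-dec_)
open import Relation.Nullary.Negation.Core using (¬_)
open import Relation.Unary using (Pred; Decidable)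

private
  variable
    ℓ : Level
    n : ℕ

-- The subset { x | P x }.
⟪_⟫ : {P : Pred (Fin n) ℓ} → Decidable P → Subset n
⟪ P? ⟫ = tabulate (λ x → does (P? x))

IsMinimumOf : Pred ℕ ℓ → ℕ → Set ℓ
IsMinimumOf P m = P m × (∀ k → P k → m ≤ k)

-- Finite simple undirected graphs of order n.  Order 0 is not excluded here;
-- IsSplitGraph below excludes it.
record Graph (n : ℕ) : Set₁ where
  infix 4 _~_ _~?_
  field
    _~_      : Fin n → Fin n → Set
    _~?_     : Binary.Decidable _~_
    ~-sym    : Binary.Symmetric _~_
    ~-irrefl : Binary.Irreflexive _≡_ _~_

module _ (G : Graph n) where
  open Graph G

  Connected : Set
  Connected = ∀ u v → Star _~_ u v

  IsClique : Subset n → Set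
  IsClique K = ∀ u v → u ∈ K → v ∈ K → u ≢ v → u ~ v

  IsMaximumClique : Subset n → Set
  IsMaximumClique C = IsClique C × (∀ K → IsClique K → ∣ K ∣ ≤ ∣ C ∣)

  IsIndependent : Subset n → Set
  IsIndependent I = ∀ u v → u ∈ I → v ∈ I → ¬ (u ~ v)

  record IsSplitGraph : Set where
    field
      connected     : Connected
      C I           : Subset n
      cover         : C ∪ I ≡ ⊤
      disjoint      : C ∩ I ≡ ⊥
      C-nonempty    : Nonempty C
      I-nonempty    : Nonempty I
      C-maximum     : IsMaximumClique C
      I-independent : IsIndependent I

  N[_] : Fin n → Subset n
  N[ v ] = ⟪ (λ u → (u ≟ᶠ v) ⊎-dec (u ~? v)) ⟫

  N[_]ₛ : Subset n → Subset n
  N[ S ]ₛ = ⟪ (λ u → any? (λ v → (v ∈? S) ×-dec (u ∈? N[ v ]))) ⟫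

  -- For X = Pⁱ(S), the set Vⁱ of vertices that can propagate.
  propagating : Subset n → Subset n
  propagating X = ⟪ (λ v → (v ∈? X) ×-dec (∣ N[ v ] ─ X ∣ ≤? 1)) ⟫

  -- Pⁱ(S) is meaningful for i ≥ 1 only; the value at 0 is a dummy, and every
  -- use below carries 1 ≤ i.
  P : Subset n → ℕ → Subset n
  P S zero          = S
  P S (suc zero)    = N[ S ]ₛ
  P S (suc (suc i)) = P S (suc i) ∪ N[ propagating (P S (suc i)) ]ₛ

  MonitoredAt : Subset n → ℕ → Set
  MonitoredAt S i = 1 ≤ i × P S i ≡ ⊤

  IsPowerDominating : Subset n → Set
  IsPowerDominating S = ∃ λ i → MonitoredAt S i

  -- γₚ(G) = k
  IsPowerDominationNumber : ℕ → Set
  IsPowerDominationNumber =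
    IsMinimumOf (λ k → ∃ λ S → IsPowerDominating S × ∣ S ∣ ≡ k)

  -- radₚ(G,S) = r
  IsPropagationRadiusFrom : Subset n → ℕ → Set
  IsPropagationRadiusFrom S = IsMinimumOf (MonitoredAt S)

  -- radₚ(G) = r
  IsPropagationRadius : ℕ → Set
  IsPropagationRadius = IsMinimumOf (λ r → ∃ λ S →
    IsPowerDominating S × IsPowerDominationNumber ∣ S ∣ × IsPropagationRadiusFrom S r)

{-# OPTIONS --safe #-}

-- The clique consists of g centres and q = p − 1 rungs.  Every centre carries two
-- leaves, and tip j is adjacent to the rungs k ≥ j.
-- Neither of two leaves at a common centre can be observed unless the power
-- dominating set meets that centre or one of the leaves, so γₚ ≥ g, and a minimum
-- set contains neither rungs nor tips.  Then one step observes the clique at best,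
-- and since rung k sees exactly the tips j ≤ k, the tips are observed in order, at
-- most one per step: p steps are necessary.  The set of all centres attains both
-- bounds.
module Submission where

open import Defs
open import Data.Nat.Base using (ℕ; _+_; _*_; _∸_; _≤_)
open import Data.Product.Base using (Σ; _×_)
open import Relation.Binary.PropositionalEquality.Core using (_≡_)
import Data.Integer.Base as ℤ
import Data.Rational.Base as ℚ

open import Data.Bool.Base using (true)
open import Data.Fin.Base using (Fin; zero; suc; toℕ; fromℕ<)
open import Data.Fin.Properties
  using (any?; suc-injective; 0≢1+n; +↔⊎; *↔×; toℕ-fromℕ<; toℕ-injective; toℕ<n)
  renaming (_≟_ to _≟ᶠ_)
open import Data.Fin.Subset
  using (Subset; inside; outside; _∈_; _∉_; _⊆_; _─_; _-_; ∁; ⊤; ∣_∣)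
open import Data.Fin.Subset.Properties
open import Data.Integer.Properties using (pos-*)
open import Data.Nat.Base using (zero; suc; _<_; z≤n; s≤s; s≤s⁻¹)
open import Data.Nat.Properties
  using (≤-refl; ≤-trans; ≤-antisym; ≤-reflexive; <-≤-trans; ≤-<-trans; <⇒≤; <-irrefl;
         n≮n; ≮⇒≥; m+n∸m≡n; m≤n⇒m<n∨m≡n)
import Data.Nat.Properties as ℕ
open import Data.Nat.Tactic.RingSolver using (solve-∀)
import Data.Integer.Tactic.RingSolver as ℤ-Ring
open import Data.Product.Base using (∃; ∃₂; _,_; proj₁; proj₂)
open import Data.Rational.Properties using (toℚᵘ-injective; toℚᵘ-fromℚᵘ; toℚᵘ-homo-+)
open import Data.Rational.Unnormalised.Base using (mkℚᵘ; *≡*)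
import Data.Rational.Unnormalised.Base as ℚᵘ
import Data.Rational.Unnormalised.Properties as ℚᵘ
open import Data.Sum.Base using (_⊎_; inj₁; inj₂)
open import Data.Sum.Function.Propositional using (_⊎-↔_)
open import Data.Sum.Properties using (≡-dec; inj₁-injective; inj₂-injective)
open import Data.Unit.Base using (tt) renaming (⊤ to 𝟙)
open import Data.Vec.Base using ([]; _∷_; here; there)
open import Data.Vec.Properties using (lookup∘tabulate; lookup⇒[]=; []=⇒lookup)
open import Data.Empty using () renaming (⊥ to 𝟘)
open import Function.Base using (_∘_; const)
open import Function.Bundles using (_↔_; Inverse)
open import Function.Construct.Composition using (_↔-∘_)
open import Function.Construct.Identity using (↔-id)
open import Level using (Level)
open import Relation.Binary.Construct.Closure.ReflexiveTransitive
  using (Star; ε; _◅_; _◅◅_; reverse)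
open import Relation.Binary.Definitions using (DecidableEquality)
import Relation.Binary.Definitions as Binary
open import Relation.Binary.PropositionalEquality
  using (_≢_; refl; sym; trans; cong; subst; subst₂; ≢-sym)
open import Relation.Nullary using (¬_; Dec; yes; no; does; contradiction)
open import Relation.Nullary.Decidable using (dec-true; _×-dec_; _⊎-dec_; ¬?)
open import Relation.Unary using (Pred; Decidable)

private
  variable
    ℓ : Level
    m n : ℕ

minimum-unique : {P : Pred ℕ ℓ} {a b : ℕ} → IsMinimumOf P a → IsMinimumOf P b → a ≡ b
minimum-unique (pa , a≤) (pb , b≤) = ≤-antisym (a≤ _ pb) (b≤ _ pa)

-- Finite subsets

does⁻ : {A : Set ℓ} (a? : Dec A) → does a? ≡ true → A
does⁻ (yes a) _ = a

module _ {P : Pred (Fin n) ℓ} (P? : Decidable P) where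

  ∈⟪⟫⁺ : ∀ {x} → P x → x ∈ ⟪ P? ⟫
  ∈⟪⟫⁺ {x} px =
    lookup⇒[]= x _ (trans (lookup∘tabulate (does ∘ P?) x) (dec-true (P? x) px))

  ∈⟪⟫⁻ : ∀ {x} → x ∈ ⟪ P? ⟫ → P x
  ∈⟪⟫⁻ {x} x∈ =
    does⁻ (P? x) (trans (sym (lookup∘tabulate (does ∘ P?) x)) ([]=⇒lookup x∈))

-- Induction on `S`: when the first vertex belongs to `S`, its image is deleted from `T`.
-- Injectivity keeps the other images inside the smaller set, and the deletion lowers the
-- cardinality strictly.
injectiveOn⇒∣∣≤∣∣ : (S : Subset m) (T : Subset n) (f : Fin m → Fin n) →
  (∀ {x} → x ∈ S → f x ∈ T) →
  (∀ {x y} → x ∈ S → y ∈ S → f x ≡ f y → x ≡ y) →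
  ∣ S ∣ ≤ ∣ T ∣
injectiveOn⇒∣∣≤∣∣ [] T f f∈T inj = z≤n
injectiveOn⇒∣∣≤∣∣ (outside ∷ S) T f f∈T inj =
  injectiveOn⇒∣∣≤∣∣ S T (f ∘ suc) (f∈T ∘ there)
    (λ x∈ y∈ eq → suc-injective (inj (there x∈) (there y∈) eq))
injectiveOn⇒∣∣≤∣∣ (inside ∷ S) T f f∈T inj =
  ≤-<-trans
    (injectiveOn⇒∣∣≤∣∣ S (T - f zero) (f ∘ suc)
      (λ x∈ → x∈p∧x≢y⇒x∈p-y (f∈T (there x∈)) (0≢1+n ∘ inj here (there x∈) ∘ sym))
      (λ x∈ y∈ eq → suc-injective (inj (there x∈) (there y∈) eq)))
    (x∈p⇒∣p-x∣<∣p∣ (f∈T here))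

∣∣≤1 : (S : Subset n) → (∀ {x y} → x ∈ S → y ∈ S → x ≡ y) → ∣ S ∣ ≤ 1
∣∣≤1 S unique = injectiveOn⇒∣∣≤∣∣ S (⊤ {1}) (const zero) (const ∈⊤) (λ x∈ y∈ _ → unique x∈ y∈)

1<∣∣ : {S : Subset n} {x y : Fin n} → x ≢ y → x ∈ S → y ∈ S → 1 < ∣ S ∣
1<∣∣ x≢y x∈ y∈ =
  ≤-<-trans (≤-<-trans z≤n (x∈p⇒∣p-x∣<∣p∣ (x∈p∧x≢y⇒x∈p-y y∈ (≢-sym x≢y))))
            (x∈p⇒∣p-x∣<∣p∣ x∈)

x∈p─q⇒x∉q : ∀ (p q : Subset n) {x} → x ∈ p ─ q → x ∉ q
x∈p─q⇒x∉q (_ ∷ p) (outside ∷ q) (there x∈) (there x∈q) = x∈p─q⇒x∉q p q x∈ x∈q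
x∈p─q⇒x∉q (_ ∷ p) (inside  ∷ q) (there x∈) (there x∈q) = x∈p─q⇒x∉q p q x∈ x∈q

full : {S : Subset n} → (∀ x → x ∈ S) → S ≡ ⊤
full all = ⊆-antisym ⊆⊤ (λ {x} _ → all x)

-- Power domination and cliques in arbitrary graphs

module _ (G : Graph n) where
  open Graph G

  -- This decider and the next two repeat those inside `N[_]`, `N[_]ₛ` and `propagating`, so that
  -- the membership lemmas for `⟪_⟫` apply by definitional unfolding.
  closed? : ∀ v → Decidable (λ u → u ≡ v ⊎ u ~ v)
  closed? v u = (u ≟ᶠ v) ⊎-dec (u ~? v)

  dominated? : ∀ S → Decidable (λ u → ∃ λ v → v ∈ S × u ∈ N[ G ] v)
  dominated? S u = any? (λ v → (v ∈? S) ×-dec (u ∈? N[ G ] v))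

  propagates? : ∀ X → Decidable (λ v → v ∈ X × ∣ N[ G ] v ─ X ∣ ≤ 1)
  propagates? X v = (v ∈? X) ×-dec (∣ N[ G ] v ─ X ∣ ℕ.≤? 1)

  ∈N⁺ : ∀ {u v} → u ≡ v ⊎ u ~ v → u ∈ N[ G ] v
  ∈N⁺ = ∈⟪⟫⁺ (closed? _)

  ∈N⁻ : ∀ {u v} → u ∈ N[ G ] v → u ≡ v ⊎ u ~ v
  ∈N⁻ = ∈⟪⟫⁻ (closed? _)

  ∈Nₛ⁺ : ∀ {S u v} → v ∈ S → u ≡ v ⊎ u ~ v → u ∈ N[ G ]ₛ S
  ∈Nₛ⁺ v∈S uv = ∈⟪⟫⁺ (dominated? _) (_ , v∈S , ∈N⁺ uv)

  ∈Nₛ⁻ : ∀ {S u} → u ∈ N[ G ]ₛ S → ∃ λ v → v ∈ S × (u ≡ v ⊎ u ~ v)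
  ∈Nₛ⁻ u∈ with ∈⟪⟫⁻ (dominated? _) u∈
  ... | v , v∈S , u∈N = v , v∈S , ∈N⁻ u∈N

  P-mono-suc : ∀ S i → P G S (suc i) ⊆ P G S (suc (suc i))
  P-mono-suc S i = p⊆p∪q _

  -- The forcing rule: since `v` itself is observed, all unobserved members of its closed
  -- neighbourhood equal `u`, so `v` propagates.
  P-step : ∀ {S i u v} → v ∈ P G S (suc i) → u ~ v →
    (∀ {w} → w ~ v → w ∉ P G S (suc i) → w ≡ u) → u ∈ P G S (suc (suc i))
  P-step {S} {i} {u} {v} v∈ u~v only =
    x∈p∪q⁺ (inj₂ (∈Nₛ⁺ (∈⟪⟫⁺ (propagates? _) (v∈ , ∣∣≤1 _ same)) (inj₂ u~v)))
    where
    is-u : ∀ {w} → w ∈ N[ G ] v ─ P G S (suc i) → w ≡ u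
    is-u w∈ with ∈N⁻ (p─q⊆p _ _ w∈)
    ... | inj₁ refl = contradiction v∈ (x∈p─q⇒x∉q _ _ w∈)
    ... | inj₂ w~v  = only w~v (x∈p─q⇒x∉q _ _ w∈)

    same : ∀ {x y} → x ∈ N[ G ] v ─ P G S (suc i) → y ∈ N[ G ] v ─ P G S (suc i) → x ≡ y
    same x∈ y∈ = trans (is-u x∈) (sym (is-u y∈))

  -- A time-dependent fort: as long as F i is unobserved at time i + 1, no vertex
  -- can force a member of F (i + 1), having two unobserved neighbours.
  evasion : (F : ℕ → Pred (Fin n) ℓ) {S : Subset n} →
    (∀ {u v} → F 0 u → v ∈ S → ¬ (u ≡ v ⊎ u ~ v)) →
    (∀ {i u} → F (suc i) u → F i u) →
    (∀ {i u v} → F (suc i) u → u ~ v →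
      ∃₂ λ x y → x ≢ y × (F i x × x ~ v) × (F i y × y ~ v)) →
    ∀ i {u} → F i u → u ∉ P G S (suc i)
  evasion F far decreasing two zero Fu u∈ with ∈Nₛ⁻ u∈
  ... | v , v∈S , uv = far Fu v∈S uv
  evasion F {S} far decreasing two (suc i) {u} Fu u∈ with x∈p∪q⁻ (P G S (suc i)) _ u∈
  ... | inj₁ u∈P = evasion F far decreasing two i (decreasing Fu) u∈P
  ... | inj₂ u∈N with ∈Nₛ⁻ u∈N
  ... | v , v∈V , uv with ∈⟪⟫⁻ (propagates? _) v∈V | uv
  ... | v∈P , _   | inj₁ refl = evasion F far decreasing two i (decreasing Fu) v∈P
  ... | v∈P , ≤1  | inj₂ u~v with two Fu u~v
  ... | x , y , x≢y , (Fx , x~v) , (Fy , y~v) =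
    n≮n 1 (<-≤-trans (1<∣∣ x≢y (unobserved Fx x~v) (unobserved Fy y~v)) ≤1)
    where
    unobserved : ∀ {w} → F i w → w ~ v → w ∈ N[ G ] v ─ P G S (suc i)
    unobserved Fw w~v =
      x∈p∧x∉q⇒x∈p─q (∈N⁺ (inj₂ w~v)) (evasion F far decreasing two i Fw)

  -- A proper colouring by the vertices of C is injective on every clique.
  colouring⇒maximum : {C : Subset n} (f : Fin n → Fin n) → IsClique G C →
    (∀ u → f u ∈ C) → (∀ {u v} → u ~ v → f u ≢ f v) → IsMaximumClique G C
  colouring⇒maximum {C} f clique f∈C proper = clique , λ K K-clique →
    injectiveOn⇒∣∣≤∣∣ K C f (λ _ → f∈C _) (injective K-clique)
    where
    injective : ∀ {K} → IsClique G K → ∀ {u v} → u ∈ K → v ∈ K → f u ≡ f v → u ≡ v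
    injective K-clique {u} {v} u∈ v∈ fu≡fv with u ≟ᶠ v
    ... | yes u≡v = u≡v
    ... | no  u≢v = contradiction fu≡fv (proper (K-clique u v u∈ v∈ u≢v))

  hub⇒connected : ∀ h → (∀ u → Star _~_ u h) → Connected G
  hub⇒connected h to-h u v = to-h u ◅◅ reverse ~-sym (to-h v)

-- The extremal graphs

module Ladder (g q : ℕ) where

  Core Pendant Vertex : Set
  Core    = Fin g ⊎ Fin q
  Pendant = (Fin 2 × Fin g) ⊎ Fin q
  Vertex  = Core ⊎ Pendant

  pattern centre i = inj₁ (inj₁ i)
  pattern rung k   = inj₁ (inj₂ k)
  pattern leaf s i = inj₂ (inj₁ (s , i))
  pattern tip j    = inj₂ (inj₂ j)

  order : ℕ
  order = (g + q) + (2 * g + q)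

  -- Adjacency is defined by cases on `Vertex`; this bijection transports it to the `Fin` vertices
  -- that `Graph` requires. The sum `order` is bracketed to match.
  encoding : Fin order ↔ Vertex
  encoding = (+↔⊎ ⊎-↔ ((*↔× ⊎-↔ ↔-id _) ↔-∘ +↔⊎)) ↔-∘ +↔⊎

  open Inverse encoding using () renaming (to to dec; from to enc)

  dec-enc : ∀ x → dec (enc x) ≡ x
  dec-enc = Inverse.strictlyInverseˡ encoding

  enc-dec : ∀ v → enc (dec v) ≡ v
  enc-dec = Inverse.strictlyInverseʳ encoding

  enc-injective : ∀ {x y} → enc x ≡ enc y → x ≡ y
  enc-injective {x} {y} eq = trans (sym (dec-enc x)) (trans (cong dec eq) (dec-enc y))

  dec-injective : ∀ {u v} → dec u ≡ dec v → u ≡ v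
  dec-injective {u} {v} eq = trans (sym (enc-dec u)) (trans (cong enc eq) (enc-dec v))

  ∀-enc : (Q : Pred (Fin order) ℓ) → (∀ x → Q (enc x)) → ∀ v → Q v
  ∀-enc Q q v = subst Q (enc-dec v) (q (dec v))

  _≟ᶜ_ : DecidableEquality Core
  _≟ᶜ_ = ≡-dec _≟ᶠ_ _≟ᶠ_

  -- Between rungs and tips this is a half graph: the rungs have nested neighbourhoods among the
  -- tips, which forces the tips to be observed one after another.
  Attached : Core → Pendant → Set
  Attached (inj₁ i) (inj₁ (_ , j)) = i ≡ j
  Attached (inj₂ k) (inj₂ j)       = toℕ j ≤ toℕ k
  Attached _        _              = 𝟘

  attached? : Binary.Decidable Attached
  attached? (inj₁ i) (inj₁ (_ , j)) = i ≟ᶠ j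
  attached? (inj₂ k) (inj₂ j)       = toℕ j ℕ.≤? toℕ k
  attached? (inj₁ _) (inj₂ _)       = no λ ()
  attached? (inj₂ _) (inj₁ _)       = no λ ()

  infix 4 _⌢_

  _⌢_ : Vertex → Vertex → Set
  inj₁ x ⌢ inj₁ y = x ≢ y
  inj₁ x ⌢ inj₂ y = Attached x y
  inj₂ x ⌢ inj₁ y = Attached y x
  inj₂ _ ⌢ inj₂ _ = 𝟘

  _⌢?_ : Binary.Decidable _⌢_
  inj₁ x ⌢? inj₁ y = ¬? (x ≟ᶜ y)
  inj₁ x ⌢? inj₂ y = attached? x y
  inj₂ x ⌢? inj₁ y = attached? y x
  inj₂ _ ⌢? inj₂ _ = no λ ()

  ⌢-sym : ∀ x y → x ⌢ y → y ⌢ x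
  ⌢-sym (inj₁ _) (inj₁ _) x≢y = ≢-sym x≢y
  ⌢-sym (inj₁ _) (inj₂ _) att = att
  ⌢-sym (inj₂ _) (inj₁ _) att = att

  ⌢-irrefl : ∀ x → ¬ (x ⌢ x)
  ⌢-irrefl (inj₁ _) x≢x = x≢x refl

  G : Graph order
  G = record
    { _~_      = λ u v → dec u ⌢ dec v
    ; _~?_     = λ u v → dec u ⌢? dec v
    ; ~-sym    = λ {u} {v} → ⌢-sym (dec u) (dec v)
    ; ~-irrefl = λ { {u} refl → ⌢-irrefl (dec u) }
    }

  open Graph G

  ~⁺ : ∀ {x y} → x ⌢ y → enc x ~ enc y
  ~⁺ {x} {y} = subst₂ _⌢_ (sym (dec-enc x)) (sym (dec-enc y))

  ~⁻ : ∀ {x y} → enc x ~ enc y → x ⌢ y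
  ~⁻ {x} {y} = subst₂ _⌢_ (dec-enc x) (dec-enc y)

  -- Lower bound on the power domination number

  owner : Vertex → Core
  -- Tip j is charged to rung j, so the vertices owned by no centre are exactly the rungs and the
  -- tips.
  owner (inj₁ x)   = x
  owner (leaf _ i) = inj₁ i
  owner (tip j)    = inj₂ j

  Owned : Core → Fin order → Set
  Owned x v = owner (dec v) ≡ x

  owned⁺ : ∀ x → Owned (owner x) (enc x)
  owned⁺ x = cong owner (dec-enc x)

  MeetsEveryCentre : Subset order → Set
  MeetsEveryCentre S = ∀ i → ∃ λ v → v ∈ S × Owned (inj₁ i) v

  -- Vertices chosen for different centres are distinct, because the owner recovers the centre.
  meets⇒g≤ : ∀ {S} → MeetsEveryCentre S → g ≤ ∣ S ∣
  meets⇒g≤ {S} meets = subst (_≤ ∣ S ∣) (∣⊤∣≡n g)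
    (injectiveOn⇒∣∣≤∣∣ ⊤ S (proj₁ ∘ meets) (λ {i} _ → proj₁ (proj₂ (meets i)))
      (λ {i} {j} _ _ eq → inj₁-injective
        (trans (sym (proj₂ (proj₂ (meets i))))
               (trans (cong (owner ∘ dec) eq) (proj₂ (proj₂ (meets j)))))))

  -- Deleting a vertex owned by a rung would leave a set that still meets every centre but has fewer
  -- than g elements.
  meets∧∣∣≤g⇒unowned : ∀ {S} → MeetsEveryCentre S → ∣ S ∣ ≤ g →
    ∀ {v k} → v ∈ S → ¬ Owned (inj₂ k) v
  meets∧∣∣≤g⇒unowned {S} meets S≤g {v} {k} v∈S owned =
    n≮n g (<-≤-trans (≤-<-trans (meets⇒g≤ meets-v) (x∈p⇒∣p-x∣<∣p∣ v∈S)) S≤g)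
    where
    meets-v : MeetsEveryCentre (S - v)
    meets-v i with meets i
    ... | w , w∈S , w-owned = w , x∈p∧x≢y⇒x∈p-y w∈S w≢v , w-owned
      where
      w≢v : w ≢ v
      w≢v refl with trans (sym w-owned) owned
      ... | ()

  leaf-neighbour : ∀ s i x → leaf s i ⌢ x → x ≡ centre i
  leaf-neighbour s i (centre .i) refl = refl

  LeafAt : Fin g → Pred (Fin order) _
  LeafAt i u = ∃ λ s → u ≡ enc (leaf s i)

  -- If `S` avoids centre i and both its leaves, the two leaves form a fort that is constant in
  -- time: their only neighbour sees both unobserved and can never force either.
  powerDominating⇒meets : ∀ {S} → IsPowerDominating G S → MeetsEveryCentre S
  powerDominating⇒meets {S} (suc k , _ , P≡⊤) i
    with any? (λ v → (v ∈? S) ×-dec (owner (dec v) ≟ᶜ inj₁ i))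
  ... | yes met = met
  ... | no  unmet = contradiction
    (subst (enc (leaf zero i) ∈_) (sym P≡⊤) ∈⊤)
    (evasion G (const (LeafAt i)) far (λ F → F) two k (zero , refl))
    where
    far : ∀ {u v} → LeafAt i u → v ∈ S → ¬ (u ≡ v ⊎ u ~ v)
    far {v = v} (s , refl) v∈S (inj₁ refl) = unmet (v , v∈S , owned⁺ (leaf s i))
    far {v = v} (s , refl) v∈S (inj₂ u~v) = unmet (v , v∈S , cong owner
      (leaf-neighbour s i (dec v) (subst (_⌢ dec v) (dec-enc (leaf s i)) u~v)))

    two : ∀ {u v} → LeafAt i u → u ~ v →
      ∃₂ λ x y → x ≢ y × (LeafAt i x × x ~ v) × (LeafAt i y × y ~ v)
    two {v = v} (s , refl) u~v =
      enc (leaf zero i) , enc (leaf (suc zero) i) , leaves≢ ,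
      ((zero , refl) , adjacent zero) , ((suc zero , refl) , adjacent (suc zero))
      where
      leaves≢ : enc (leaf zero i) ≢ enc (leaf (suc zero) i)
      leaves≢ eq with enc-injective {leaf zero i} {leaf (suc zero) i} eq
      ... | ()

      adjacent : ∀ t → enc (leaf t i) ~ v
      adjacent t = subst₂ _⌢_ (sym (dec-enc (leaf t i)))
        (sym (leaf-neighbour s i (dec v) (subst (_⌢ dec v) (dec-enc (leaf s i)) u~v))) refl

  -- Lower bound on the propagation radius

  tip-neighbour : ∀ j x → tip j ⌢ x → ∃ λ k → x ≡ rung k × toℕ j ≤ toℕ k
  tip-neighbour j (rung k) j≤k = k , refl , j≤k

  TipFrom : ℕ → Pred (Fin order) _
  TipFrom i u = ∃ λ j → i ≤ toℕ j × u ≡ enc (tip j)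

  -- The fort shrinks by one tip per step: at time i + 1 all tips of index at least i are still
  -- unobserved. Hence everything can be observed at time i + 1 only if no such tip exists, that is,
  -- if q ≤ i.
  monitored⇒q< : ∀ {S} → (∀ {v k} → v ∈ S → ¬ Owned (inj₂ k) v) →
    ∀ {i} → MonitoredAt G S i → suc q ≤ i
  monitored⇒q< {S} unowned {suc i} (_ , P≡⊤) = s≤s (≮⇒≥ λ i<q → contradiction
    (subst (enc (tip (fromℕ< i<q)) ∈_) (sym P≡⊤) ∈⊤)
    (evasion G TipFrom far decreasing two i
      (fromℕ< i<q , ≤-reflexive (sym (toℕ-fromℕ< i<q)) , refl)))
    where
    far : ∀ {u v} → TipFrom 0 u → v ∈ S → ¬ (u ≡ v ⊎ u ~ v)
    far (j , _ , refl) v∈S (inj₁ refl) = unowned v∈S (owned⁺ (tip j))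
    far {v = v} (j , _ , refl) v∈S (inj₂ u~v)
      with tip-neighbour j (dec v) (subst (_⌢ dec v) (dec-enc (tip j)) u~v)
    ... | k , v≡rung , _ = unowned v∈S (cong owner v≡rung)

    decreasing : ∀ {i u} → TipFrom (suc i) u → TipFrom i u
    decreasing (j , i<j , eq) = j , <⇒≤ i<j , eq

    two : ∀ {i u v} → TipFrom (suc i) u → u ~ v →
      ∃₂ λ x y → x ≢ y × (TipFrom i x × x ~ v) × (TipFrom i y × y ~ v)
    two {i} {v = v} (j , i<j , refl) u~v
      with tip-neighbour j (dec v) (subst (_⌢ dec v) (dec-enc (tip j)) u~v)
    ... | k , v≡rung , j≤k =
      -- A rung adjacent to tip j also sees every earlier tip, in particular tip i, which leaves the
      -- fort only at the next step.
      enc (tip i′) , enc (tip j) , i′≢j ,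
      ((i′ , ≤-reflexive (sym i′≡i) , refl) ,
        subst₂ _⌢_ (sym (dec-enc (tip i′))) (sym v≡rung)
          (≤-trans (≤-reflexive i′≡i) (≤-trans (<⇒≤ i<j) j≤k))) ,
      ((j , <⇒≤ i<j , refl) , u~v)
      where
      i<q : i < q
      i<q = <-≤-trans i<j (<⇒≤ (toℕ<n j))

      i′ : Fin q
      i′ = fromℕ< i<q

      i′≡i : toℕ i′ ≡ i
      i′≡i = toℕ-fromℕ< i<q

      i′≢j : enc (tip i′) ≢ enc (tip j)
      i′≢j eq = <-irrefl (trans (sym i′≡i) (cong toℕ
        (inj₂-injective (inj₂-injective (enc-injective {tip i′} {tip j} eq))))) i<j

  -- Observation starting from all centres

  centre? : Decidable (λ v → ∃ λ i → v ≡ enc (centre i))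
  centre? v = any? (λ i → v ≟ᶠ enc (centre i))

  centres : Subset order
  centres = ⟪ centre? ⟫

  centre∈ : ∀ i → enc (centre i) ∈ centres
  centre∈ i = ∈⟪⟫⁺ centre? (i , refl)

  ∣centres∣≤g : (i₀ : Fin g) → ∣ centres ∣ ≤ g
  ∣centres∣≤g i₀ = subst (∣ centres ∣ ≤_) (∣⊤∣≡n g)
    (injectiveOn⇒∣∣≤∣∣ centres ⊤ (index ∘ dec) (const ∈⊤) injective)
    where
    index : Vertex → Fin g
    index (centre i) = i
    -- Default value; injectivity is checked on centres only.
    index _          = i₀

    injective : ∀ {u v} → u ∈ centres → v ∈ centres → index (dec u) ≡ index (dec v) → u ≡ v
    injective u∈ v∈ eq with ∈⟪⟫⁻ centre? u∈ | ∈⟪⟫⁻ centre? v∈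
    ... | i , refl | j , refl = cong (enc ∘ inj₁ ∘ inj₁)
      (trans (sym (cong index (dec-enc (centre i)))) (trans eq (cong index (dec-enc (centre j)))))

  -- Invariant with an offset of one: stage i refers to time i + 1, since the first step observes
  -- the core and the leaves but is not credited with any tip.
  Reached : ℕ → Vertex → Set
  Reached i (tip j) = toℕ j < i
  Reached i _       = 𝟙

  P-centres : Fin g → ∀ i x → Reached i x → enc x ∈ P G centres (suc i)
  P-centres i₀ zero (centre i) _ = ∈Nₛ⁺ G (centre∈ i) (inj₁ refl)
  P-centres i₀ zero (rung k)   _ = ∈Nₛ⁺ G (centre∈ i₀) (inj₂ (~⁺ {rung k} {centre i₀} λ ()))
  P-centres i₀ zero (leaf s i) _ = ∈Nₛ⁺ G (centre∈ i) (inj₂ (~⁺ {leaf s i} {centre i} refl))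
  P-centres i₀ (suc i) (centre l) _ = P-mono-suc G centres i (P-centres i₀ i (centre l) tt)
  P-centres i₀ (suc i) (rung k)   _ = P-mono-suc G centres i (P-centres i₀ i (rung k) tt)
  P-centres i₀ (suc i) (leaf s l) _ = P-mono-suc G centres i (P-centres i₀ i (leaf s l) tt)
  P-centres i₀ (suc i) (tip j) j≤i with m≤n⇒m<n∨m≡n (s≤s⁻¹ j≤i)
  ... | inj₁ j<i = P-mono-suc G centres i (P-centres i₀ i (tip j) j<i)
  -- Rung i forces tip i: its core neighbours and the tips below i are already observed, and it is
  -- not adjacent to later tips.
  ... | inj₂ j≡i = P-step G {centres} {i} (P-centres i₀ i (rung j) tt) (~⁺ {tip j} {rung j} ≤-refl)
    (λ {w} → ∀-enc (λ w → w ~ enc (rung j) → w ∉ P G centres (suc i) → w ≡ enc (tip j)) only w)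
    where
    only : ∀ x → enc x ~ enc (rung j) → enc x ∉ P G centres (suc i) → enc x ≡ enc (tip j)
    only (inj₁ (inj₁ l)) _ unseen = contradiction (P-centres i₀ i (centre l) tt) unseen
    only (inj₁ (inj₂ k)) _ unseen = contradiction (P-centres i₀ i (rung k) tt) unseen
    only (leaf s l) _ unseen = contradiction (P-centres i₀ i (leaf s l) tt) unseen
    only (tip l) l~j unseen with m≤n⇒m<n∨m≡n (~⁻ {tip l} {rung j} l~j)
    ... | inj₁ l<j = contradiction (P-centres i₀ i (tip l) (<-≤-trans l<j (≤-reflexive j≡i))) unseen
    ... | inj₂ l≡j = cong (enc ∘ inj₂ ∘ inj₂) (toℕ-injective l≡j)

  centres-monitored : Fin g → MonitoredAt G centres (suc q)
  centres-monitored i₀ = s≤s z≤n , full (∀-enc _ λ x → P-centres i₀ q x (reached x))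
    where
    reached : ∀ x → Reached q x
    reached (inj₁ _)   = tt
    reached (leaf _ _) = tt
    reached (tip j)    = toℕ<n j

  -- Exact values of the two parameters

  powerDominationNumber : Fin g → IsPowerDominationNumber G g
  powerDominationNumber i₀ =
    (centres , dominating , ≤-antisym (∣centres∣≤g i₀) (meets⇒g≤ (powerDominating⇒meets dominating)))
    , λ { k (S , S-dominating , refl) → meets⇒g≤ (powerDominating⇒meets S-dominating) }
    where
    dominating : IsPowerDominating G centres
    dominating = suc q , centres-monitored i₀

  propagationRadius : Fin g → IsPropagationRadius G (suc q)
  propagationRadius i₀ =
    (centres , dominating , subst (IsPowerDominationNumber G) (sym ∣centres∣≡g) γ≡g
      , monitored , λ k → lower dominating (∣centres∣≤g i₀))
    , λ { k (S , S-dominating , γ≡∣S∣ , S-monitored , _) →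
            -- Uniqueness of the minimum gives `S` exactly g elements, so it contains no rung and no
            -- tip.
            lower S-dominating (≤-reflexive (minimum-unique γ≡∣S∣ γ≡g)) S-monitored }
    where
    monitored = centres-monitored i₀

    dominating : IsPowerDominating G centres
    dominating = suc q , monitored

    γ≡g = powerDominationNumber i₀

    ∣centres∣≡g : ∣ centres ∣ ≡ g
    ∣centres∣≡g =
      ≤-antisym (∣centres∣≤g i₀) (meets⇒g≤ (powerDominating⇒meets dominating))

    lower : ∀ {S k} → IsPowerDominating G S → ∣ S ∣ ≤ g → MonitoredAt G S k → suc q ≤ k
    lower S-dominating S≤g =
      monitored⇒q< (meets∧∣∣≤g⇒unowned (powerDominating⇒meets S-dominating) S≤g)

  -- Split structure

  connected : Fin g → Connected G
  connected i₀ = hub⇒connected G (enc (centre i₀)) (∀-enc _ to-hub)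
    where
    core-to-hub : ∀ x → Star _~_ (enc (inj₁ x)) (enc (centre i₀))
    core-to-hub x with x ≟ᶜ inj₁ i₀
    ... | yes refl = ε
    ... | no  x≢i₀ = ~⁺ {inj₁ x} {centre i₀} x≢i₀ ◅ ε

    to-hub : ∀ x → Star _~_ (enc x) (enc (centre i₀))
    to-hub (inj₁ x)   = core-to-hub x
    to-hub (leaf s i) = ~⁺ {leaf s i} {centre i} refl ◅ core-to-hub (inj₁ i)
    to-hub (tip j)    = ~⁺ {tip j} {rung j} ≤-refl ◅ core-to-hub (inj₂ j)

  IsCore : Vertex → Set
  IsCore (inj₁ _) = 𝟙
  IsCore (inj₂ _) = 𝟘

  isCore? : Decidable IsCore
  isCore? (inj₁ _) = yes tt
  isCore? (inj₂ _) = no λ ()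

  core : Subset order
  core = ⟪ isCore? ∘ dec ⟫

  core⁻ : ∀ {v} → v ∈ core → IsCore (dec v)
  core⁻ = ∈⟪⟫⁻ (isCore? ∘ dec)

  core⁺ : ∀ x → enc (inj₁ x) ∈ core
  core⁺ x = ∈⟪⟫⁺ (isCore? ∘ dec) (subst IsCore (sym (dec-enc (inj₁ x))) tt)

  core-clique : IsClique G core
  core-clique u v u∈ v∈ u≢v =
    go (dec u) (dec v) (core⁻ u∈) (core⁻ v∈) (u≢v ∘ dec-injective)
    where
    go : ∀ x y → IsCore x → IsCore y → x ≢ y → x ⌢ y
    go (inj₁ x) (inj₁ y) _ _ x≢y = x≢y ∘ cong inj₁

  -- Each pendant vertex takes the colour of a core vertex not adjacent to it. A tip takes a centre;
  -- a leaf takes a core vertex other than its own centre, which is what `other` supplies.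
  core-maximum : Fin g → (∀ i → ∃ λ x → x ≢ inj₁ i) → IsMaximumClique G core
  core-maximum i₀ other =
    colouring⇒maximum G (enc ∘ inj₁ ∘ colour ∘ dec) core-clique (λ u → core⁺ (colour (dec u)))
      (λ {u} {v} u~v eq → proper (dec u) (dec v) u~v 
        (inj₁-injective
          (enc-injective {inj₁ (colour (dec u))} {inj₁ (colour (dec v))} eq)))
    where
    colour : Vertex → Core
    colour (inj₁ x)   = x
    colour (leaf _ i) = proj₁ (other i)
    colour (tip _)    = inj₁ i₀

    proper : ∀ x y → x ⌢ y → colour x ≢ colour y
    proper (inj₁ _)   (inj₁ _)   x≢y  = x≢y
    proper (centre i) (leaf _ i) refl = ≢-sym (proj₂ (other i))
    proper (leaf _ i) (centre i) refl = proj₂ (other i)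
    proper (rung _)   (tip _)    _    = λ ()
    proper (tip _)    (rung _)   _    = λ ()

  pendant-independent : IsIndependent G (∁ core)
  pendant-independent u v u∈ v∈ =
    go (dec u) (dec v) (x∈∁p⇒x∉p u∈ ∘ ∈⟪⟫⁺ (isCore? ∘ dec)) (x∈∁p⇒x∉p v∈ ∘ ∈⟪⟫⁺ (isCore? ∘ dec))
    where
    go : ∀ x y → ¬ IsCore x → ¬ IsCore y → ¬ (x ⌢ y)
    go (inj₁ _) _        x∉ _  = contradiction tt x∉
    go (inj₂ _) (inj₁ _) _  y∉ = contradiction tt y∉
    go (inj₂ _) (inj₂ _) _  _  = λ ()

  isSplit : Fin g → (∀ i → ∃ λ x → x ≢ inj₁ i) → IsSplitGraph G
  isSplit i₀ other = record
    { connected     = connected i₀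
    ; C             = core
    ; I             = ∁ core
    ; cover         = p∪∁p≡⊤ core
    ; disjoint      = ∩-inverseʳ core
    ; C-nonempty    = _ , core⁺ (inj₁ i₀)
    ; I-nonempty    = enc (leaf zero i₀) ,
        x∉p⇒x∈∁p (subst IsCore (dec-enc (leaf zero i₀)) ∘ core⁻)
    ; C-maximum     = core-maximum i₀ other
    ; I-independent = pendant-independent
    }

-- For g = p = 1 the graph is a path on three vertices, whose maximum clique must
-- also contain a leaf.
path-isSplit : IsSplitGraph (Ladder.G 1 0)
path-isSplit = record
  { connected     = Ladder.connected 1 0 zero
  ; C             = edge
  ; I             = ∁ edge
  ; cover         = refl
  ; disjoint      = refl
  ; C-nonempty    = zero , here
  ; I-nonempty    = suc (suc zero) , there (there here)
  ; C-maximum     = colouring⇒maximum (Ladder.G 1 0) colour clique colour∈ proper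
  ; I-independent = independent
  }
  where
  open Graph (Ladder.G 1 0)

  -- Under the encoding, 0 is the centre and 1 and 2 are its leaves; the clique takes the first
  -- leaf.
  edge : Subset 3
  edge = inside ∷ inside ∷ outside ∷ []

  clique : IsClique (Ladder.G 1 0) edge
  clique zero       zero       _ _ u≢v = contradiction refl u≢v
  clique zero       (suc zero) _ _ _   = refl
  clique (suc zero) zero       _ _ _   = refl
  clique (suc zero) (suc zero) _ _ u≢v = contradiction refl u≢v
  clique (suc (suc zero)) _ (there (there ())) _ _
  clique zero (suc (suc zero)) _ (there (there ())) _
  clique (suc zero) (suc (suc zero)) _ (there (there ())) _

  colour : Fin 3 → Fin 3
  colour zero    = zero
  colour (suc _) = suc zero

  colour∈ : ∀ u → colour u ∈ edge
  colour∈ zero    = here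
  colour∈ (suc _) = there here

  proper : ∀ {u v} → u ~ v → colour u ≢ colour v
  proper {zero}  {zero}  u~v = contradiction refl u~v
  proper {zero}  {suc _} _   = λ ()
  proper {suc _} {zero}  _   = λ ()
  proper {suc zero}       {suc zero}       ()
  proper {suc zero}       {suc (suc zero)} ()
  proper {suc (suc zero)} {suc zero}       ()
  proper {suc (suc zero)} {suc (suc zero)} ()

  independent : IsIndependent (Ladder.G 1 0) (∁ edge)
  independent zero       _ () _
  independent (suc zero) _ (there ()) _
  independent (suc (suc zero)) zero _ ()
  independent (suc (suc zero)) (suc zero) _ (there ())
  independent (suc (suc zero)) (suc (suc zero)) _ _ ()

-- A core vertex different from a given centre is a rung if there is one, and otherwise another
-- centre; only the path has neither.
ladder-isSplit : ∀ g q → IsSplitGraph (Ladder.G (suc g) q)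
ladder-isSplit zero    zero    = path-isSplit
ladder-isSplit g       (suc q) = Ladder.isSplit (suc g) (suc q) zero λ i → inj₂ zero , λ ()
ladder-isSplit (suc g) zero    = Ladder.isSplit (suc (suc g)) 0 zero other
  where
  other : ∀ (i : Fin (suc (suc g))) → ∃ λ (x : Fin (suc (suc g)) ⊎ Fin 0) → x ≢ inj₁ i
  other zero    = inj₁ (suc zero) , λ ()
  other (suc i) = inj₁ zero , λ ()

-- Arithmetic of the order and the radius

order-eq : ∀ g q → (g + q) + (2 * g + q) ≡ 3 * g + 2 * q
order-eq = solve-∀

-- Passing to unnormalised rationals turns the equation into an integer identity by
-- cross-multiplication; the numerator of the fraction over 2 is 2q.
radius-eq : ∀ g q →
  (ℤ.+ suc q) ℚ./ 1 ≡ ((ℤ.+ Ladder.order g q ℤ.- ℤ.+ (3 * g)) ℚ./ 2) ℚ.+ ℚ.1ℚ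
radius-eq g q = toℚᵘ-injective (begin
    ℚ.toℚᵘ ((ℤ.+ suc q) ℚ./ 1)           ≈⟨ toℚᵘ-fromℚᵘ (mkℚᵘ (ℤ.+ suc q) 0) ⟩
    -- The second argument of `mkℚᵘ` is the denominator minus one, so 0 stands for 1 and 1 stands
    -- for 2.
    mkℚᵘ (ℤ.+ suc q) 0                   ≈⟨ *≡* (cross (ℤ.+ q)) ⟩
    mkℚᵘ (ℤ.+ 2 ℤ.* ℤ.+ q) 1 ℚᵘ.+ ℚᵘ.1ℚᵘ ≡⟨ cong (λ z → mkℚᵘ z 1 ℚᵘ.+ ℚᵘ.1ℚᵘ) (sym difference) ⟩
    mkℚᵘ d 1 ℚᵘ.+ ℚᵘ.1ℚᵘ                 ≈⟨ ℚᵘ.+-congˡ ℚᵘ.1ℚᵘ (ℚᵘ.≃-sym (toℚᵘ-fromℚᵘ (mkℚᵘ d 1))) ⟩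
    ℚ.toℚᵘ (d ℚ./ 2) ℚᵘ.+ ℚᵘ.1ℚᵘ         ≈⟨ toℚᵘ-homo-+ (d ℚ./ 2) ℚ.1ℚ ⟨
    ℚ.toℚᵘ (d ℚ./ 2 ℚ.+ ℚ.1ℚ)            ∎)
  where
  open import Relation.Binary.Reasoning.Setoid ℚᵘ.≃-setoid

  d = ℤ.+ Ladder.order g q ℤ.- ℤ.+ (3 * g)

  difference : d ≡ ℤ.+ 2 ℤ.* ℤ.+ q
  difference = trans (cong (λ m → ℤ.+ m ℤ.- ℤ.+ (3 * g)) (order-eq g q))
    (trans (cancel (ℤ.+ (3 * g)) (ℤ.+ (2 * q))) (pos-* 2 q))
    where
    cancel : ∀ a b → (a ℤ.+ b) ℤ.- a ≡ b
    cancel = ℤ-Ring.solve-∀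

  cross : ∀ z → (ℤ.1ℤ ℤ.+ z) ℤ.* ℤ.+ 2 ≡ (ℤ.+ 2 ℤ.* z ℤ.* ℤ.1ℤ ℤ.+ ℤ.1ℤ ℤ.* ℤ.+ 2) ℤ.* ℤ.1ℤ
  cross = ℤ-Ring.solve-∀

mainTheorem6 : ∀ (p g : ℕ) → 1 ≤ p → 1 ≤ g →
    Σ ℕ λ n → Σ (Graph n) λ G →
    n ≡ 3 * g + 2 * p ∸ 2
    × IsSplitGraph G
    × IsPowerDominationNumber G g
    × IsPropagationRadius G p
    × (∀ γ r → IsPowerDominationNumber G γ → IsPropagationRadius G r →
    (ℤ.+ r) ℚ./ 1 ≡ ((ℤ.+ n ℤ.- ℤ.+ (3 * γ)) ℚ./ 2) ℚ.+ ℚ.1ℚ)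
mainTheorem6 (suc q) (suc g) _ _ =
  order , G , trans (order-eq (suc g) q) (sym (truncated (suc g) q)) , ladder-isSplit g q ,
  γ≡ , rad≡ , formula
  where
  open Ladder (suc g) q

  γ≡ = powerDominationNumber zero

  rad≡ = propagationRadius zero

  -- Since p = q + 1, the minuend is at least 2 and the natural-number subtraction is exact.
  truncated : ∀ g q → 3 * g + 2 * suc q ∸ 2 ≡ 3 * g + 2 * q
  truncated g q = trans (cong (_∸ 2) (shift g q)) (m+n∸m≡n 2 (3 * g + 2 * q))
    where
    shift : ∀ g q → 3 * g + 2 * suc q ≡ 2 + (3 * g + 2 * q)
    shift = solve-∀

  formula : ∀ γ r → IsPowerDominationNumber G γ → IsPropagationRadius G r →
    (ℤ.+ r) ℚ./ 1 ≡ ((ℤ.+ order ℤ.- ℤ.+ (3 * γ)) ℚ./ 2) ℚ.+ ℚ.1ℚ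
  formula γ r γ-min r-min
    -- Uniqueness of minima replaces the arbitrary `γ` and `r` by the values already computed.
    with minimum-unique γ-min γ≡ | minimum-unique r-min rad≡
  ... | refl | refl = radius-eq (suc g) q
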